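{- Let $L$ and $K$ be complete lattices and suppose $L$ is a parametrisation of $K$ through a family $(f_i:L\to K)_{i\in I}$. Let $O:L\to L$ be an operator and $A$ an approximator of $O$ such that both $O$ and $A$ respect each $f_i$, and let $(x,y)$ be the $A$-well-founded fixpoint of $O$. Then: (1) for each $i\in I$, $(f_i(x),f_i(y))$ is the $A_{f_i}$-well-founded fixpoint of $O_{f_i}$; (2) if the $A_{f_i}$-well-founded fixpoint of $O_{f_i}$ is exact for every $i\in I$, then the $A$-well-founded fixpoint of $O$ is exact.
   Context: $L$ is a parametrisation of $K$ through $(f_i)_{i\in I}$ if each $f_i:L\to K$ is a surjective lattice morphism (i.e. $f_i(\bigvee X)=\bigvee f_i(X)$ and $f_i(\bigwedge X)=\bigwedge f_i(X)$ for all $X\subseteq L$) and for all $x,y\in L$: $x\leq y$ iff $f_i(x)\leq f_i(y)$ for all $i\in I$. $L^2$ carries the precision order $(x,y)\leq_p(u,v)$ iff $x\leq u$ and $v\leq y$; $(x,y)_1=x,(x,y)_2=y$; a pair $(x,y)$ is exact if $x=y$. An approximator of $O$ is a $\leq_p$-monotone $A:L^2\to L^2$ with $A(x,x)_1\leq O(x)\leq A(x,x)_2$ for all $x$, assumed symmetric ($A(x,y)_1=A(y,x)_2$). $O$ respects $f$ if $f(x)=f(y)$ implies $f(O(x))=f(O(y))$; $O_f$ is the unique operator with $O_f\circ f=f\circ O$. With $f^2(x,y)=(f(x),f(y))$, $A$ respects $f$ if $f^2(p)=f^2(q)$ implies $f^2(A(p))=f^2(A(q))$, and $A_f$ is the unique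 operator with $A_f\circ f^2=f^2\circ A$. For an operator $B$ on $M^2$ and $P$ on $M$, a partial $B$-stable fixpoint is $(x,y)$ with $x=\mathrm{lfp}(B(\cdot,y)_1)$, $y=\mathrm{lfp}(B(x,\cdot)_2)$; the $B$-well-founded fixpoint of $P$ is the $\leq_p$-least partial $B$-stable fixpoint. -}

module Defs where

open import Data.Product.Base using (_×_; _,_; ∃-syntax; proj₁; proj₂)
open import Data.Product.Function.NonDependent.Setoid using (_×-surjection_)
open import Data.Product.Relation.Binary.Pointwise.NonDependent using (_×ₛ_)
open import Function.Bundles using (Func; Surjection; _⇔_)
open import Level using (Level; _⊔_; suc)
open import Relation.Binary.Bundles using (Setoid; Poset)
open import Relation.Binary.Core using (Rel)
open import Relation.Unary using (Pred; _∈_)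

private
  variable
    c ℓ ι e : Level

-- Subsets of the carrier are predicates valued in the universe of the carrier.
record CompleteLattice ℓ : Set (suc ℓ) where
  field
    poset : Poset ℓ ℓ ℓ

  open Poset poset public
    using (Carrier; _≈_; _≤_; isPartialOrder; antisym; module Eq)
    renaming (refl to ≤-refl; trans to ≤-trans; reflexive to ≤-reflexive)

  field
    ⋁ : Pred Carrier ℓ → Carrier
    ⋀ : Pred Carrier ℓ → Carrier
    ⋁-upper    : ∀ X {x} → x ∈ X → x ≤ ⋁ X
    ⋁-least    : ∀ X {u} → (∀ {x} → x ∈ X → x ≤ u) → ⋁ X ≤ u
    ⋀-lower    : ∀ X {x} → x ∈ X → ⋀ X ≤ x
    ⋀-greatest : ∀ X {l} → (∀ {x} → x ∈ X → l ≤ x) → l ≤ ⋀ X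

  setoid : Setoid ℓ ℓ
  setoid = Eq.setoid

  setoid² : Setoid ℓ ℓ
  setoid² = setoid ×ₛ setoid

  infix 4 _≤ₚ_

  _≤ₚ_ : Rel (Carrier × Carrier) ℓ
  (x , y) ≤ₚ (u , v) = x ≤ u × v ≤ y

  Exact : Pred (Carrier × Carrier) ℓ
  Exact (x , y) = x ≈ y

Operator : CompleteLattice ℓ → Set ℓ
Operator L = Func (CompleteLattice.setoid L) (CompleteLattice.setoid L)

Operator² : CompleteLattice ℓ → Set ℓ
Operator² L = Func (CompleteLattice.setoid² L) (CompleteLattice.setoid² L)

module _ (L K : CompleteLattice ℓ) where
  private
    module L = CompleteLattice L
    module K = CompleteLattice K

  image : (L.Carrier → K.Carrier) → Pred L.Carrier ℓ → Pred K.Carrier ℓ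
  image f X k = ∃[ x ] x ∈ X × f x K.≈ k

  record IsLatticeMorphism (f : L.Carrier → K.Carrier) : Set (suc ℓ) where
    field
      pres-⋁ : ∀ X → f (L.⋁ X) K.≈ K.⋁ (image f X)
      pres-⋀ : ∀ X → f (L.⋀ X) K.≈ K.⋀ (image f X)

  record IsParametrisation {I : Set ι} (f : I → Surjection L.setoid K.setoid)
                           : Set (suc ℓ ⊔ ι) where
    field
      isLatticeMorphism : ∀ i → IsLatticeMorphism (Surjection.to (f i))
      ≤⇔ : ∀ x y →
           x L.≤ y ⇔ (∀ i → Surjection.to (f i) x K.≤ Surjection.to (f i) y)

module _ (L : CompleteLattice ℓ) where
  open CompleteLattice L

  record IsApproximator (O : Operator L) (A : Operator² L) : Set ℓ where
    open Func O using () renaming (to to O⟨_⟩)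
    open Func A using () renaming (to to A⟨_⟩)
    field
      monotone  : ∀ {p q} → p ≤ₚ q → A⟨ p ⟩ ≤ₚ A⟨ q ⟩
      lower     : ∀ x → proj₁ A⟨ x , x ⟩ ≤ O⟨ x ⟩
      upper     : ∀ x → O⟨ x ⟩ ≤ proj₂ A⟨ x , x ⟩
      symmetric : ∀ x y → proj₁ A⟨ x , y ⟩ ≈ proj₂ A⟨ y , x ⟩

  record IsLfp (h : Carrier → Carrier) (x : Carrier) : Set ℓ where
    field
      fixpoint : h x ≈ x
      least    : ∀ {z} → h z ≈ z → x ≤ z

  IsPartialStableFixpoint : Operator² L → Pred (Carrier × Carrier) ℓ
  IsPartialStableFixpoint B (x , y) =
    IsLfp (λ z → proj₁ (B.to (z , y))) x × IsLfp (λ z → proj₂ (B.to (x , z))) y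
    where module B = Func B

  -- "p is the B-well-founded fixpoint of P".  P only records which operator
  -- B approximates; the notion itself is determined by B.
  record IsWellFoundedFixpoint (B : Operator² L) (P : Operator L)
                               (p : Carrier × Carrier) : Set ℓ where
    field
      stable : IsPartialStableFixpoint B p
      least  : ∀ {q} → IsPartialStableFixpoint B q → p ≤ₚ q

module _ {S T : Setoid c e} (f : Surjection S T) (F : Func S S) where
  private
    module T = Setoid T
    module f = Surjection f
    module F = Func F

  Respects : Set (c ⊔ e)
  Respects = ∀ {x y} → f.to x T.≈ f.to y → f.to (F.to x) T.≈ f.to (F.to y)

  IsInduced : Func T T → Set (c ⊔ e)
  IsInduced G = ∀ x → Func.to G (f.to x) T.≈ f.to (F.to x)

  -- F_f, computed on a chosen preimage; by the two lemmas below it is the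
  -- unique operator with F_f ∘ f ≈ f ∘ F.
  induced : Respects → Func T T
  induced resp = record
    { to   = λ k → f.to (F.to (f.to⁻ k))
    ; cong = λ {k} {k′} k≈k′ →
        resp (T.trans (f.to∘to⁻ k) (T.trans k≈k′ (T.sym (f.to∘to⁻ k′))))
    }

  induced-isInduced : (resp : Respects) → IsInduced (induced resp)
  induced-isInduced resp x = resp (f.to∘to⁻ (f.to x))

  induced-unique : (resp : Respects) (G : Func T T) → IsInduced G →
                   ∀ k → Func.to G k T.≈ Func.to (induced resp) k
  induced-unique resp G comm k =
    T.trans (Func.cong G (T.sym (f.to∘to⁻ k))) (comm (f.to⁻ k))

infix 8 _²

_² : {S T : Setoid c e} → Surjection S T → Surjection (S ×ₛ S) (T ×ₛ T)
f ² = f ×-surjection f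

{-# OPTIONS --safe #-}
-- The A-well-founded fixpoint is the least fixpoint, in the precision order,
-- of the stable operator S(u,v) = (lfp A(·,v)₁ , lfp A(u,·)₂).  Every k in K
-- has a greatest and a least preimage under a surjective lattice morphism f.
-- If a monotone h maps preimages of k to preimages of k, then the greatest
-- preimage of k is a prefixpoint of h, so f (lfp h) ≤ k.
-- Used with the sections of A this shows that f commutes with lfp; used with S
-- on L² it gives leastness of (f x , f y).  Exactness transfers back since the
-- family jointly reflects the order.
module Submission where

open import Data.Product.Base using (_×_; _,_; ∃-syntax; proj₁; proj₂)
open import Data.Product.Relation.Binary.Pointwise.NonDependent using (×-isEquivalence)
open import Function.Bundles using (Func; Surjection; Equivalence)
open import Level using (Level)
open import Relation.Binary.Definitions using (Monotonic₁)
open import Relation.Unary using (Pred)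
open import Defs

private
  variable
    ℓ : Level

module LeastFixpoint (L : CompleteLattice ℓ) where
  open CompleteLattice L

  -- The Knaster-Tarski formula: the meet of all prefixpoints.
  lfp : (Carrier → Carrier) → Carrier
  lfp h = ⋀ (λ z → h z ≤ z)

  lfp-mono : ∀ {g h} → (∀ z → g z ≤ h z) → lfp g ≤ lfp h
  lfp-mono g≤h = ⋀-greatest _ λ {z} hz≤z → ⋀-lower _ (≤-trans (g≤h z) hz≤z)

  IsLfp-unique : ∀ {h x y} → IsLfp L h x → IsLfp L h y → x ≈ y
  IsLfp-unique p q = antisym (P.least Q.fixpoint) (Q.least P.fixpoint)
    where
    module P = IsLfp p
    module Q = IsLfp q

  module _ {h : Carrier → Carrier} (mono : Monotonic₁ _≤_ _≤_ h) where

    mono⇒cong : ∀ {x y} → x ≈ y → h x ≈ h y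
    mono⇒cong x≈y = antisym (mono (≤-reflexive x≈y)) (mono (≤-reflexive (Eq.sym x≈y)))

    lfp-prefixpoint : h (lfp h) ≤ lfp h
    lfp-prefixpoint = ⋀-greatest _ λ hz≤z → ≤-trans (mono (⋀-lower _ hz≤z)) hz≤z

    lfp-isLfp : IsLfp L h (lfp h)
    lfp-isLfp = record
      { fixpoint = antisym lfp-prefixpoint (⋀-lower _ (mono lfp-prefixpoint))
      ; least    = λ hz≈z → ⋀-lower _ (≤-reflexive hz≈z)
      }

    IsLfp-resp-≈ : ∀ {x y} → x ≈ y → IsLfp L h x → IsLfp L h y
    IsLfp-resp-≈ x≈y p = record
      { fixpoint = Eq.trans (mono⇒cong (Eq.sym x≈y)) (Eq.trans fixpoint x≈y)
      ; least    = λ hz≈z → ≤-trans (≤-reflexive (Eq.sym x≈y)) (least hz≈z)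
      }
      where open IsLfp p

    -- `IsLfp` compares `x` with fixpoints only. The passage to prefixpoints goes through `lfp h`,
    -- which is a fixpoint by monotonicity and lies below every prefixpoint by construction.
    IsLfp-≤-prefixpoint : ∀ {x z} → IsLfp L h x → h z ≤ z → x ≤ z
    IsLfp-≤-prefixpoint p hz≤z =
      ≤-trans (IsLfp.least p (IsLfp.fixpoint lfp-isLfp)) (⋀-lower _ hz≤z)

-- The product of `L` with its order dual, so joins and meets swap in the second coordinate. As a
-- complete lattice it brings the stable operator within reach of the results on least fixpoints.
precision : CompleteLattice ℓ → CompleteLattice ℓ
precision {ℓ} L = record
  { poset = record
    { Carrier = Carrier × Carrier
    ; _≈_ = λ (x , y) (u , v) → x ≈ u × y ≈ v
    ; _≤_ = _≤ₚ_
    ; isPartialOrder = record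
      { isPreorder = record
        { isEquivalence = ×-isEquivalence Eq.isEquivalence Eq.isEquivalence
        ; reflexive = λ (p , q) → ≤-reflexive p , ≤-reflexive (Eq.sym q)
        ; trans = λ (p , q) (p′ , q′) → ≤-trans p p′ , ≤-trans q′ q
        }
      ; antisym = λ (p , q) (p′ , q′) → antisym p p′ , antisym q′ q
      }
    }
  ; ⋁ = λ X → ⋁ (fsts X) , ⋀ (snds X)
  ; ⋀ = λ X → ⋀ (fsts X) , ⋁ (snds X)
  ; ⋁-upper = λ X p∈X → ⋁-upper _ (_ , p∈X) , ⋀-lower _ (_ , p∈X)
  ; ⋁-least = λ X X≤u → ⋁-least _ (λ (_ , p∈X) → proj₁ (X≤u p∈X))
                      , ⋀-greatest _ (λ (_ , p∈X) → proj₂ (X≤u p∈X))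
  ; ⋀-lower = λ X p∈X → ⋀-lower _ (_ , p∈X) , ⋁-upper _ (_ , p∈X)
  ; ⋀-greatest = λ X l≤X → ⋀-greatest _ (λ (_ , p∈X) → proj₁ (l≤X p∈X))
                         , ⋁-least _ (λ (_ , p∈X) → proj₂ (l≤X p∈X))
  }
  where
  open CompleteLattice L
  fsts snds : Pred (Carrier × Carrier) ℓ → Pred Carrier ℓ
  fsts X x = ∃[ y ] X (x , y)
  snds X y = ∃[ x ] X (x , y)

module _ (L K : CompleteLattice ℓ) where
  private
    module L = CompleteLattice L
    module K = CompleteLattice K

  record IsGreatestPreimage (f : L.Carrier → K.Carrier) (k : K.Carrier)
                            (u : L.Carrier) : Set ℓ where
    field
      preimage : f u K.≈ k
      greatest : ∀ {w} → f w K.≈ k → w L.≤ u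

  -- Only monotonicity of `f` and one greatest preimage enter, so the same lemma serves `f` from `L`
  -- to `K` and `f ²` between the precision lattices.
  IsLfp-image-≤ : ∀ {f} → Monotonic₁ L._≤_ K._≤_ f →
                  ∀ {h} → Monotonic₁ L._≤_ L._≤_ h →
                  ∀ {k u} → IsGreatestPreimage f k u →
                  (∀ {w} → f w K.≈ k → f (h w) K.≈ k) →
                  ∀ {x} → IsLfp L h x → f x K.≤ k
  IsLfp-image-≤ f-mono h-mono gp closed x-lfp =
    K.≤-trans (f-mono (IsLfp-≤-prefixpoint h-mono x-lfp (greatest (closed preimage))))
              (K.≤-reflexive preimage)
    where
    open LeastFixpoint L
    open IsGreatestPreimage gp

module SurjectiveMorphism (L K : CompleteLattice ℓ)
  (f : Surjection (CompleteLattice.setoid L) (CompleteLattice.setoid K))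
  (f-morphism : IsLatticeMorphism L K (Surjection.to f)) where
  private
    module L = CompleteLattice L
    module K = CompleteLattice K
    module f = Surjection f
  open IsLatticeMorphism f-morphism

  -- Preservation of joins gives this: `y` is the join of its down-set, which contains `x`.
  f-mono : Monotonic₁ L._≤_ K._≤_ f.to
  f-mono {x} {y} x≤y =
    K.≤-trans (K.⋁-upper _ (x , x≤y , K.Eq.refl))
      (K.≤-trans (K.≤-reflexive (K.Eq.sym (pres-⋁ (L._≤ y))))
                 (K.≤-reflexive (f.cong (L.antisym (L.⋁-least _ λ w≤y → w≤y)
                                                   (L.⋁-upper _ L.≤-refl)))))

  -- The candidate is the value at `k` of the upper adjoint of `f`. Its image is at most `k` because
  -- `f` preserves joins, and at least `k` because surjectivity puts a preimage of `k` into `below`.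
  f-greatestPreimage : ∀ k → ∃[ u ] IsGreatestPreimage L K f.to k u
  f-greatestPreimage k = L.⋁ below , record
    { preimage = K.antisym
        (K.≤-trans (K.≤-reflexive (pres-⋁ below))
                   (K.⋁-least _ λ (_ , fw≤k , fw≈z) →
                     K.≤-trans (K.≤-reflexive (K.Eq.sym fw≈z)) fw≤k))
        (K.≤-trans (K.≤-reflexive (K.Eq.sym (f.to∘to⁻ k)))
                   (f-mono (L.⋁-upper below (K.≤-reflexive (f.to∘to⁻ k)))))
    ; greatest = λ fw≈k → L.⋁-upper below (K.≤-reflexive fw≈k)
    }
    where
    below : Pred L.Carrier _
    below w = f.to w K.≤ k

  f-leastPreimage : ∀ k → ∃[ v ] f.to v K.≈ k × (∀ {w} → f.to w K.≈ k → v L.≤ w)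
  f-leastPreimage k = L.⋀ above
    , K.antisym
        (K.≤-trans (f-mono (L.⋀-lower above (K.≤-reflexive (K.Eq.sym (f.to∘to⁻ k)))))
                   (K.≤-reflexive (f.to∘to⁻ k)))
        (K.≤-trans (K.⋀-greatest _ λ (_ , k≤fw , fw≈z) →
                     K.≤-trans k≤fw (K.≤-reflexive fw≈z))
                   (K.≤-reflexive (K.Eq.sym (pres-⋀ above))))
    , λ fw≈k → L.⋀-lower above (K.≤-reflexive (K.Eq.sym fw≈k))
    where
    above : Pred L.Carrier _
    above w = k K.≤ f.to w

  f²-mono : ∀ {p q} → p L.≤ₚ q → Surjection.to (f ²) p K.≤ₚ Surjection.to (f ²) q
  f²-mono (x≤u , v≤y) = f-mono x≤u , f-mono v≤y

  -- The precision order reverses the second coordinate, so a greatest preimage there is paired with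
  -- a least one.
  f²-greatestPreimage : ∀ q → ∃[ p ]
    IsGreatestPreimage (precision L) (precision K) (Surjection.to (f ²)) q p
  f²-greatestPreimage (a , b) with f-greatestPreimage a | f-leastPreimage b
  ... | u , gp | v , fv≈b , v-least = (u , v) , record
    { preimage = preimage , fv≈b
    ; greatest = λ (fw≈a , fw′≈b) → greatest fw≈a , v-least fw′≈b
    }
    where open IsGreatestPreimage gp

  IsLfp-image : ∀ {h} → Monotonic₁ L._≤_ L._≤_ h →
                ∀ {k} → (∀ {a b} → a K.≈ b → k a K.≈ k b) →
                (∀ w → k (f.to w) K.≈ f.to (h w)) →
                ∀ {x} → IsLfp L h x → IsLfp K k (f.to x)
  IsLfp-image h-mono k-cong comm {x} x-lfp = record
    { fixpoint = K.Eq.trans (comm x) (f.cong (IsLfp.fixpoint x-lfp))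
    ; least    = λ {z} kz≈z →
        IsLfp-image-≤ L K f-mono h-mono (proj₂ (f-greatestPreimage z))
          -- If `f w` equals the fixpoint `z` of `k`, then `f (h w) ≈ k (f w) ≈ k z ≈ z`: preimages
          -- of `z` are closed under `h`.
          (λ {w} fw≈z → K.Eq.trans (K.Eq.sym (comm w)) (K.Eq.trans (k-cong fw≈z) kz≈z))
          x-lfp
    }

module StableOperator (L : CompleteLattice ℓ) (A : Operator² L)
  (A-mono : Monotonic₁ (CompleteLattice._≤ₚ_ L) (CompleteLattice._≤ₚ_ L) (Func.to A)) where
  open CompleteLattice L
  open LeastFixpoint L
  private
    module A = Func A

  section₁-mono : ∀ v → Monotonic₁ _≤_ _≤_ (λ z → proj₁ (A.to (z , v)))
  section₁-mono v z≤z′ = proj₁ (A-mono (z≤z′ , ≤-refl))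

  section₂-mono : ∀ u → Monotonic₁ _≤_ _≤_ (λ z → proj₂ (A.to (u , z)))
  section₂-mono u z≤z′ = proj₂ (A-mono (≤-refl , z≤z′))

  S : Carrier × Carrier → Carrier × Carrier
  S (u , v) = lfp (λ z → proj₁ (A.to (z , v))) , lfp (λ z → proj₂ (A.to (u , z)))

  -- A more precise pair has a smaller `v` and a larger `u`. By monotonicity of `A` the first
  -- section then rises pointwise and the second falls.
  S-mono : Monotonic₁ _≤ₚ_ _≤ₚ_ S
  S-mono (u≤u′ , v′≤v) = lfp-mono (λ z → proj₁ (A-mono (≤-refl , v′≤v)))
                       , lfp-mono (λ z → proj₂ (A-mono (u≤u′ , ≤-refl)))

  wellFounded⇒IsLfp : ∀ {P p} → IsWellFoundedFixpoint L A P p → IsLfp (precision L) S p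
  wellFounded⇒IsLfp {p = x , y} wf = record
    { fixpoint = IsLfp-unique (lfp-isLfp (section₁-mono y)) (proj₁ stable)
               , IsLfp-unique (lfp-isLfp (section₂-mono x)) (proj₂ stable)
    -- A fixpoint of `S` is a partial stable fixpoint: being a least fixpoint transfers along `≈`
    -- from the computed `lfp` to `u` and `v`.
    ; least    = λ {(u , v)} (Su≈u , Sv≈v) → least
        ( IsLfp-resp-≈ (section₁-mono v) Su≈u (lfp-isLfp (section₁-mono v))
        , IsLfp-resp-≈ (section₂-mono u) Sv≈v (lfp-isLfp (section₂-mono u)) )
    }
    where open IsWellFoundedFixpoint wf

wellFounded-unique : (L : CompleteLattice ℓ) → let open CompleteLattice L in
  ∀ {B P p q} → IsWellFoundedFixpoint L B P p → IsWellFoundedFixpoint L B P q →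
  proj₁ p ≈ proj₁ q × proj₂ p ≈ proj₂ q
wellFounded-unique L p-wf q-wf =
  CompleteLattice.antisym (precision L) (P.least Q.stable) (Q.least P.stable)
  where
  module P = IsWellFoundedFixpoint p-wf
  module Q = IsWellFoundedFixpoint q-wf

module _ (L K : CompleteLattice ℓ)
  (f : Surjection (CompleteLattice.setoid L) (CompleteLattice.setoid K))
  (f-morphism : IsLatticeMorphism L K (Surjection.to f))
  (A : Operator² L)
  (A-mono : Monotonic₁ (CompleteLattice._≤ₚ_ L) (CompleteLattice._≤ₚ_ L) (Func.to A))
  (A-resp : Respects (f ²) A) where
  private
    module L = CompleteLattice L
    module K = CompleteLattice K
    module f = Surjection f
    A-f = induced (f ²) A A-resp
    module A = Func A
    module A-f = Func A-f
  open SurjectiveMorphism L K f f-morphism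
  open StableOperator L A A-mono

  -- The relation of `A-f` to `A` makes `f` intertwine the two sections. Allowing any preimage `v`
  -- of `b` is what the leastness argument requires, where `b` comes from an arbitrary stable pair
  -- of `K`.
  section₁-image : ∀ {v b x} → f.to v K.≈ b → IsLfp L (λ z → proj₁ (A.to (z , v))) x →
                   IsLfp K (λ z → proj₁ (A-f.to (z , b))) (f.to x)
  section₁-image {v} fv≈b = IsLfp-image (section₁-mono v)
    (λ a≈a′ → proj₁ (A-f.cong (a≈a′ , K.Eq.refl)))
    (λ w → K.Eq.trans (proj₁ (A-f.cong (K.Eq.refl , K.Eq.sym fv≈b)))
                      (proj₁ (induced-isInduced (f ²) A A-resp (w , v))))

  section₂-image : ∀ {u a y} → f.to u K.≈ a → IsLfp L (λ z → proj₂ (A.to (u , z))) y →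
                   IsLfp K (λ z → proj₂ (A-f.to (a , z))) (f.to y)
  section₂-image {u} fu≈a = IsLfp-image (section₂-mono u)
    (λ b≈b′ → proj₂ (A-f.cong (K.Eq.refl , b≈b′)))
    (λ w → K.Eq.trans (proj₂ (A-f.cong (K.Eq.sym fu≈a , K.Eq.refl)))
                      (proj₂ (induced-isInduced (f ²) A A-resp (u , w))))

  wellFounded-image : ∀ {P Q x y} → IsWellFoundedFixpoint L A P (x , y) →
                      IsWellFoundedFixpoint K A-f Q (f.to x , f.to y)
  wellFounded-image wf = record
    { stable = section₁-image K.Eq.refl (proj₁ stable)
             , section₂-image K.Eq.refl (proj₂ stable)
    ; least  = λ {q} (a-lfp , b-lfp) →
        IsLfp-image-≤ (precision L) (precision K) f²-mono S-mono
          (proj₂ (f²-greatestPreimage q))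
          -- `S` maps preimages of `q` to preimages of `q`: the image of each component of
          -- `S (u , v)` and the matching component of `q` are least fixpoints of the same section
          -- of `A-f`.
          (λ {(u , v)} (fu≈a , fv≈b) →
              LeastFixpoint.IsLfp-unique K
                (section₁-image fv≈b (LeastFixpoint.lfp-isLfp L (section₁-mono v))) a-lfp
            , LeastFixpoint.IsLfp-unique K
                (section₂-image fu≈a (LeastFixpoint.lfp-isLfp L (section₂-mono u))) b-lfp)
          (wellFounded⇒IsLfp wf)
    }
    where open IsWellFoundedFixpoint wf

theorem3p6 : {ℓ ι : Level} (L K : CompleteLattice ℓ) {I : Set ι}
    (f : I → Surjection (CompleteLattice.setoid L) (CompleteLattice.setoid K)) →
    IsParametrisation L K f →
    (O : Operator L) (A : Operator² L) →
    IsApproximator L O A →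
    (O-resp : ∀ i → Respects (f i) O) →
    (A-resp : ∀ i → Respects (f i ²) A) →
    ∀ x y → IsWellFoundedFixpoint L A O (x , y) →
    (∀ i → IsWellFoundedFixpoint K (induced (f i ²) A (A-resp i)) (induced (f i) O (O-resp i)) (Surjection.to (f i) x , Surjection.to (f i) y))
    ×
    ((∀ i → ∃[ p ] IsWellFoundedFixpoint K (induced (f i ²) A (A-resp i)) (induced (f i) O (O-resp i)) p × CompleteLattice.Exact K p)
    → CompleteLattice.Exact L (x , y))
theorem3p6 L K f param O A approx O-resp A-resp x y wf = image-wf , λ exact →
    L.antisym (Equivalence.from (≤⇔ x y) λ i → K.≤-reflexive (fx≈fy exact i))
              (Equivalence.from (≤⇔ y x) λ i → K.≤-reflexive (K.Eq.sym (fx≈fy exact i)))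
  where
  module L = CompleteLattice L
  module K = CompleteLattice K
  open IsParametrisation param

  WF : ∀ i → K.Carrier × K.Carrier → Set _
  WF i = IsWellFoundedFixpoint K (induced (f i ²) A (A-resp i)) (induced (f i) O (O-resp i))

  image-wf : ∀ i → WF i (Surjection.to (f i) x , Surjection.to (f i) y)
  image-wf i = wellFounded-image L K (f i) (isLatticeMorphism i) A
                 (IsApproximator.monotone approx) (A-resp i) wf

  fx≈fy : (∀ i → ∃[ p ] WF i p × K.Exact p) →
          ∀ i → Surjection.to (f i) x K.≈ Surjection.to (f i) y
  fx≈fy exact i with exact i
  -- The exact pair `p` is some well-founded fixpoint in `K`; uniqueness identifies it with the
  -- image of `(x , y)`, which is therefore exact.
  ... | p , p-wf , p-exact with wellFounded-unique K (image-wf i) p-wf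
  ...   | fx≈p₁ , fy≈p₂ = K.Eq.trans fx≈p₁ (K.Eq.trans p-exact (K.Eq.sym fy≈p₂))
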